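{- Let $w_1,w_2,w_3$ be any odd positive integers. Then for every integer $n\ge 0$ and all $y_1,y_2\in\mathbb{Z}_p$, the following six expressions are equal: \begin{align*} &\sum_{k+l+m=n}\binom{n}{k,l,m}E_{k,\chi}(w_1y_1)E_{l,\chi}(w_2y_2)T_m(w_3d-1,\chi)\,w_{1}^{l+m}w_{2}^{k+m}w_{3}^{k+l}\\ =&\sum_{k+l+m=n}\binom{n}{k,l,m}E_{k,\chi}(w_1y_1)E_{l,\chi}(w_3y_2)T_m(w_2d-1,\chi)\,w_{1}^{l+m}w_{3}^{k+m}w_{2}^{k+l}\\ =&\sum_{k+l+m=n}\binom{n}{k,l,m}E_{k,\chi}(w_2y_1)E_{l,\chi}(w_1y_2)T_m(w_3d-1,\chi)\,w_{2}^{l+m}w_{1}^{k+m}w_{3}^{k+l}\\ =&\sum_{k+l+m=n}\binom{n}{k,l,m}E_{k,\chi}(w_2y_1)E_{l,\chi}(w_3y_2)T_m(w_1d-1,\chi)\,w_{2}^{l+m}w_{3}^{k+m}w_{1}^{k+l}\\ =&\sum_{k+l+m=n}\binom{n}{k,l,m}E_{k,\chi}(w_3y_1)E_{l,\chi}(w_2y_2)T_m(w_1d-1,\chi)\,w_{3}^{l+m}w_{2}^{k+m}w_{1}^{k+l}\\ =&\sum_{k+l+m=n}\binom{n}{k,l,m}E_{k,\chi}(w_3y_1)E_{l,\chi}(w_1y_2)T_m(w_2d-1,\chi)\,w_{3}^{l+m}w_{1}^{k+m}w_{2}^{k+l}. \end{align*} Here each sum is over all nonnegative integers $k,l,m$ with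 $k+l+m=n$.
   Context: $p$ is a fixed odd prime, $\mathbb{Z}_p$ is the ring of $p$-adic integers, and $\mathbb{C}_p$ is the completion of an algebraic closure of $\mathbb{Q}_p$. $d$ is a fixed odd positive integer and $\chi$ is a (primitive) Dirichlet character of conductor $d$, with values in $\overline{\mathbb{Q}}$, regarded as $\mathbb{C}_p$-valued through a fixed embedding $\overline{\mathbb{Q}}\to\mathbb{C}_p$; as usual $\chi(a)=0$ when $\gcd(a,d)>1$ (and $\chi\equiv 1$ if $d=1$). The generalized Euler polynomials $E_{n,\chi}(x)$ attached to $\chi$ are the polynomials in $x$ defined by $$\frac{2e^{xt}}{e^{dt}+1}\sum_{a=0}^{d-1}(-1)^a\chi(a)e^{at}=\sum_{n=0}^{\infty}E_{n,\chi}(x)\frac{t^n}{n!}.$$ For integers $k,n\ge 0$, the $k$th alternating generalized power sum attached to $\chi$ is $T_k(n,\chi)=\sum_{a=0}^{n}(-1)^a\chi(a)a^k$, with the convention $0^0=1$. The multinomial coefficient is $\binom{n}{k,l,m}=\frac{n!}{k!\,l!\,m!}$. -}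

module Defs where

open import Algebra.Apartness.Bundles using (HeytingField; module HeytingCommutativeRing)
open import Algebra.Bundles using (module CommutativeRing)
open import Algebra.Bundles.Raw using (RawRing)
import Algebra.Definitions.RawSemiring as RawSemiringDefinitions
open import Algebra.Morphism.Structures using (module RingMorphisms)
open import Data.Fin.Base using (toℕ)
import Data.Integer.Base as ℤ
open import Data.Integer.Base using (ℤ; +_; -[1+_]; 0ℤ; 1ℤ)
open import Data.Integer.Coprimality using (Coprime)
open import Data.Integer.Divisibility.Signed
  using (_∣_; divides; ∣m∣n⇒∣m+n; ∣m⇒∣-m; ∣m⇒∣m*n; ∣n⇒∣m*n)
open import Data.Integer.Tactic.RingSolver using (solve-∀)
open import Data.List.Base using (List; []; _∷_; _++_; [_]; map)
open import Data.List.Relation.Unary.All using (All)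
open import Data.Nat.Base using (ℕ; zero; suc; _∸_; _!; _/_; NonZero; _≥_)
import Data.Nat.Base as ℕ
import Data.Nat.Divisibility as ℕ
open import Data.Nat.Properties using (m*n≢0; _!≢0)
open import Data.Product.Base using (∃-syntax; _×_; proj₁)
open import Data.Rational.Base using (ℚ; 0ℚ; 1ℚ)
import Data.Rational.Base as ℚ
open import Level using (Level; _⊔_) renaming (suc to lsuc)
open import Relation.Binary.PropositionalEquality using (_≡_; subst)
open import Relation.Nullary.Negation using (¬_)
open import Relation.Unary using (Pred; U)

-- Since 2 ∣ 0, an odd number is positive.
Odd : ℕ → Set
Odd n = ¬ (2 ℕ.∣ n)

multinomial : (n k l m : ℕ) → ℕ
multinomial n k l m = n ! / (k ! ℕ.* l ! ℕ.* m !)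
  where instance _ = m*n≢0 (k ! ℕ.* l !) (m !) {{m*n≢0 (k !) (l !) {{k !≢0}} {{l !≢0}}}} {{m !≢0}}

------------------------------------------------------------------------
-- Sums, polynomials and formal power series

module RingOperations {c ℓ} (R : RawRing c ℓ) where
  open RawRing R public
  open RawSemiringDefinitions rawSemiring public using (_^_; sum) renaming (_×_ to _·_)

  -- Sum of f 0, …, f (n - 1).
  sum< : ℕ → (ℕ → Carrier) → Carrier
  sum< n f = sum {n} (λ i → f (toℕ i))

  fromℕ : ℕ → Carrier
  fromℕ n = n · 1#

  fromℤ : ℤ → Carrier
  fromℤ (+ n)      = fromℕ n
  fromℤ (-[1+ n ]) = - fromℕ (suc n)

-- A polynomial is its list of coefficients, lowest degree first; trailing
-- zeros are allowed and ignored by the equality.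
module Polynomials {c ℓ} (R : RawRing c ℓ) where
  open RingOperations R

  Poly : Set c
  Poly = List Carrier

  coefficient : Poly → ℕ → Carrier
  coefficient []      _       = 0#
  coefficient (a ∷ p) zero    = a
  coefficient (a ∷ p) (suc n) = coefficient p n

  _⊕_ : Poly → Poly → Poly
  []      ⊕ q       = q
  (a ∷ p) ⊕ []      = a ∷ p
  (a ∷ p) ⊕ (b ∷ q) = (a + b) ∷ (p ⊕ q)

  _⊗_ : Poly → Poly → Poly
  []      ⊗ q = []
  (a ∷ p) ⊗ q = map (a *_) q ⊕ (0# ∷ (p ⊗ q))

  polynomialRing : RawRing c ℓ
  polynomialRing = record
    { Carrier = Poly
    ; _≈_     = λ p q → ∀ n → coefficient p n ≈ coefficient q n
    ; _+_     = _⊕_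
    ; _*_     = _⊗_
    ; -_      = map -_
    ; 0#      = []
    ; 1#      = [ 1# ]
    }

  X : Poly
  X = 0# ∷ 1# ∷ []

  evaluate : Poly → Carrier → Carrier
  evaluate []      x = 0#
  evaluate (a ∷ p) x = a + x * evaluate p x

  -- Xⁿ + aₙ₋₁ Xⁿ⁻¹ + … + a₀ for the list a₀, …, aₙ₋₁.
  monic : List Carrier → Poly
  monic as = as ++ [ 1# ]

module PowerSeries {c ℓ} (R : RawRing c ℓ) where
  open RingOperations R

  Series : Set c
  Series = ℕ → Carrier

  constant : Carrier → Series
  constant a zero    = a
  constant a (suc _) = 0#

  seriesRing : RawRing c ℓ
  seriesRing = record
    { Carrier = Series
    ; _≈_     = λ f g → ∀ n → f n ≈ g n
    ; _+_     = λ f g n → f n + g n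
    ; _*_     = λ f g n → sum< (suc n) (λ i → f i * g (n ∸ i))
    ; -_      = λ f n → - f n
    ; 0#      = constant 0#
    ; 1#      = constant 1#
    }

  -- Long division: the quotient f / g, where u is the inverse of the
  -- constant term of g.
  quotient : (f g : Series) (u : Carrier) → Series
  quotient f g u zero    = u * f 0
  quotient f g u (suc n) = quotient (λ i → f (suc i) + - (u * f 0 * g (suc i))) g u n

------------------------------------------------------------------------
-- Fields

rawRing : ∀ {c ℓ₁ ℓ₂} → HeytingField c ℓ₁ ℓ₂ → RawRing c ℓ₁
rawRing F = CommutativeRing.rawRing
  (HeytingCommutativeRing.commutativeRing (HeytingField.heytingCommutativeRing F))

module _ {c ℓ₁ ℓ₂} (F : HeytingField c ℓ₁ ℓ₂) where
  open HeytingField F using (Carrier; _≈_; _#_; 0#; 1#)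
  open RingOperations (rawRing F) using (fromℕ; fromℤ; _·_)
  open Polynomials (rawRing F) using (evaluate; monic)

  CharacteristicZero : Set ℓ₂
  CharacteristicZero = ∀ n → fromℕ (suc n) # 0#

  IsRational : Pred Carrier ℓ₁
  IsRational x = ∃[ n ] ∃[ m ] (suc n · x ≈ fromℤ m)

  AlgebraicOver : ∀ {s} → Pred Carrier s → Pred Carrier (c ⊔ ℓ₁ ⊔ s)
  AlgebraicOver S x = ∃[ as ] (All S as × evaluate (monic as) x ≈ 0#)

  -- Every monic polynomial of positive degree with coefficients in S has a root.
  HasRootsOver : ∀ {s} → Pred Carrier s → Set (c ⊔ ℓ₁ ⊔ s)
  HasRootsOver S = ∀ a as → All S (a ∷ as) → ∃[ x ] (evaluate (monic (a ∷ as)) x ≈ 0#)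

-- An algebraic closure of the field of rational numbers.
record AlgebraicClosureOfℚ c ℓ₁ ℓ₂ : Set (lsuc (c ⊔ ℓ₁ ⊔ ℓ₂)) where
  field
    heytingField        : HeytingField c ℓ₁ ℓ₂
    characteristicZero  : CharacteristicZero heytingField
    algebraic           : ∀ x → AlgebraicOver heytingField (IsRational heytingField) x
    algebraicallyClosed : HasRootsOver heytingField U

  open HeytingField heytingField public

------------------------------------------------------------------------
-- p-adic integers, as the inverse limit of the rings ℤ / pⁿ

record ℤₚ (p : ℕ) : Set where
  field
    residue  : ℕ → ℤ
    coherent : ∀ n → (+ (p ℕ.^ n)) ∣ (residue (suc n) ℤ.- residue n)

module _ (p : ℕ) where
  open ℤₚ
  private
    constantly : ℤ → ℤₚ p
    constantly a .residue  _ = a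
    constantly a .coherent n = divides 0ℤ (lemma a (+ (p ℕ.^ n)))
      where
      lemma : ∀ a q → a ℤ.- a ≡ 0ℤ ℤ.* q
      lemma = solve-∀

    add : ℤₚ p → ℤₚ p → ℤₚ p
    add x y .residue  n = residue x n ℤ.+ residue y n
    add x y .coherent n =
      subst (_ ∣_) (lemma (residue x (suc n)) (residue x n) (residue y (suc n)) (residue y n))
        (∣m∣n⇒∣m+n (coherent x n) (coherent y n))
      where
      lemma : ∀ a a′ b b′ → (a ℤ.- a′) ℤ.+ (b ℤ.- b′) ≡ (a ℤ.+ b) ℤ.- (a′ ℤ.+ b′)
      lemma = solve-∀

    multiply : ℤₚ p → ℤₚ p → ℤₚ p
    multiply x y .residue  n = residue x n ℤ.* residue y n
    multiply x y .coherent n =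
      subst (_ ∣_) (lemma (residue x (suc n)) (residue x n) (residue y (suc n)) (residue y n))
        (∣m∣n⇒∣m+n (∣m⇒∣m*n (residue y (suc n)) (coherent x n))
                   (∣n⇒∣m*n (residue x n) (coherent y n)))
      where
      lemma : ∀ a a′ b b′ →
        (a ℤ.- a′) ℤ.* b ℤ.+ a′ ℤ.* (b ℤ.- b′) ≡ a ℤ.* b ℤ.- a′ ℤ.* b′
      lemma = solve-∀

    negate : ℤₚ p → ℤₚ p
    negate x .residue  n = ℤ.- residue x n
    negate x .coherent n =
      subst (_ ∣_) (lemma (residue x (suc n)) (residue x n)) (∣m⇒∣-m (coherent x n))
      where
      lemma : ∀ a a′ → ℤ.- (a ℤ.- a′) ≡ (ℤ.- a) ℤ.- (ℤ.- a′)
      lemma = solve-∀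

  ℤₚ-rawRing : RawRing _ _
  ℤₚ-rawRing = record
    { Carrier = ℤₚ p
    ; _≈_     = λ x y → ∀ n → (+ (p ℕ.^ n)) ∣ (residue x n ℤ.- residue y n)
    ; _+_     = add
    ; _*_     = multiply
    ; -_      = negate
    ; 0#      = constantly 0ℤ
    ; 1#      = constantly 1ℤ
    }

------------------------------------------------------------------------
-- The field ℂₚ

-- ℂₚ is specified, up to isometric isomorphism, as a complete valued field
-- containing ℤₚ in which the elements algebraic over ℚₚ are dense and form an
-- algebraically closed field: it is the completion of an algebraic closure of ℚₚ.
-- The absolute value is x ↦ p^(- v x), and v is rational-valued because the
-- value group of ℂₚ is ℚ.  The valuation of 0 is not a rational number, so v
-- takes a proof that its argument is apart from 0.
record Complexₚ (p : ℕ) c ℓ₁ ℓ₂ : Set (lsuc (c ⊔ ℓ₁ ⊔ ℓ₂)) where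
  field
    heytingField       : HeytingField c ℓ₁ ℓ₂
    characteristicZero : CharacteristicZero heytingField

  open HeytingField heytingField public
  open RingOperations (rawRing heytingField) public using (_·_; fromℕ)

  field
    v      : ∀ x → x # 0# → ℚ
    v-cong : ∀ {x y} (x#0 : x # 0#) (y#0 : y # 0#) → x ≈ y → v x x#0 ≡ v y y#0
    v-*    : ∀ {x y} (x#0 : x # 0#) (y#0 : y # 0#) (xy#0 : x * y # 0#) →
             v (x * y) xy#0 ≡ v x x#0 ℚ.+ v y y#0

  -- r ≤ v x, with the convention v 0 = ∞.
  _≤v_ : ℚ → Carrier → Set ℓ₂
  r ≤v x = (x#0 : x # 0#) → r ℚ.≤ v x x#0

  field
    v-+ : ∀ {r x y} → r ≤v x → r ≤v y → r ≤v (x + y)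
    v-p : (p#0 : fromℕ p # 0#) → v (fromℕ p) p#0 ≡ 1ℚ

    complete : (s : ℕ → Carrier) →
      (∀ r → ∃[ N ] (∀ m n → m ≥ N → n ≥ N → r ≤v (s m - s n))) →
      ∃[ x ] (∀ r → ∃[ N ] (∀ n → n ≥ N → r ≤v (s n - x)))

    ι                  : ℤₚ p → Carrier
    ι-isMonomorphism   : RingMorphisms.IsRingMonomorphism (ℤₚ-rawRing p) (rawRing heytingField) ι
    ι-integral         : ∀ z → 0ℚ ≤v ι z

  IsPAdicNumber : Pred Carrier ℓ₁
  IsPAdicNumber x = ∃[ n ] ∃[ z ] ((p ℕ.^ n) · x ≈ ι z)

  IsAlgebraic : Pred Carrier (c ⊔ ℓ₁)
  IsAlgebraic = AlgebraicOver heytingField IsPAdicNumber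

  field
    algebraicallyClosed : HasRootsOver heytingField IsAlgebraic
    algebraicDense      : ∀ x r → ∃[ a ] (IsAlgebraic a × r ≤v (x - a))

------------------------------------------------------------------------
-- Dirichlet characters

record DirichletCharacter {c ℓ₁ ℓ₂} (F : HeytingField c ℓ₁ ℓ₂) (d : ℕ) : Set (c ⊔ ℓ₁) where
  open HeytingField F using (Carrier; _≈_; _*_; 0#; 1#)
  field
    χ        : ℤ → Carrier
    periodic : ∀ {a b} → (+ d) ∣ (a ℤ.- b) → χ a ≈ χ b
    χ-*      : ∀ a b → χ (a ℤ.* b) ≈ χ a * χ b
    χ-1      : χ 1ℤ ≈ 1#
    vanishes : ∀ {a} → ¬ Coprime a (+ d) → χ a ≈ 0#

  -- d is the conductor: χ is not induced from a proper divisor f of d.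
  IsPrimitive : Set ℓ₁
  IsPrimitive = ∀ f → f ℕ.∣ d →
    (∀ a → Coprime a (+ d) → (+ f) ∣ (a ℤ.- 1ℤ) → χ a ≈ 1#) → f ≡ d

------------------------------------------------------------------------
-- Generalized Euler polynomials and alternating power sums

module GeneralizedEuler {c ℓ₁ ℓ₂} (F : HeytingField c ℓ₁ ℓ₂)
  (characteristicZero : CharacteristicZero F) where

  private
    module K       = RingOperations (rawRing F)
    module K[x]    = RingOperations (Polynomials.polynomialRing (rawRing F))
    module K[x]⟦t⟧ = RingOperations (PowerSeries.seriesRing (Polynomials.polynomialRing (rawRing F)))
  open Polynomials (rawRing F) using (Poly; X; evaluate)
  open PowerSeries (Polynomials.polynomialRing (rawRing F)) using (Series; constant; quotient)

  inverse : (n : ℕ) .{{_ : NonZero n}} → K.Carrier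
  inverse (suc n) = proj₁ (HeytingField.#⇒invertible F (characteristicZero n))

  -- The series e^(q t), for a polynomial q in x.
  exp : Poly → Series
  exp q n = [ inverse (n !) {{n !≢0}} ] K[x].* (q K[x].^ n)

  module _ (d : ℕ) (χ : ℕ → K.Carrier) where

    -- The constant term of e^(d t) + 1 is 2.
    generatingFunction : Series
    generatingFunction = quotient
      ((1# + 1#) * exp X *
        sum< d (λ a → (- 1#) ^ a * constant [ χ a ] * exp (K[x].fromℕ a)))
      (exp (K[x].fromℕ d) + 1#)
      [ inverse 2 ]
      where open K[x]⟦t⟧

    eulerPolynomial : ℕ → Poly
    eulerPolynomial n = (n !) K[x].· generatingFunction n

    E : ℕ → K.Carrier → K.Carrier
    E n x = evaluate (eulerPolynomial n) x

    T : ℕ → ℕ → K.Carrier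
    T k n = sum< (suc n) (λ a → (- 1#) ^ a * χ a * fromℕ a ^ k)
      where open K

    -- The inner sum runs over l ≤ n - k, and m is n - k - l.
    tripleSum : (n w₁ w₂ w₃ : ℕ) (y₁ y₂ : K.Carrier) → K.Carrier
    tripleSum n w₁ w₂ w₃ y₁ y₂ =
      sum< (suc n) λ k → sum< (suc (n ∸ k)) λ l → let m = n ∸ k ∸ l in
        fromℕ (multinomial n k l m)
          * E k (fromℕ w₁ * y₁) * E l (fromℕ w₂ * y₂) * T m (w₃ ℕ.* d ∸ 1)
          * fromℕ w₁ ^ (l ℕ.+ m) * fromℕ w₂ ^ (k ℕ.+ m) * fromℕ w₃ ^ (k ℕ.+ l)
      where open K

{-# OPTIONS --safe #-}
{-
Let H(t) = Σ_{a < d} (-1)^a χ(a) e^(a t) / (e^(d t) + 1).  Then 2 e^(y t) H(t) is the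
exponential generating function of the values E_{n,χ}(y).  As d and w are odd, the
terms of Σ_{a < w d} (-1)^a χ(a) e^(a t) get multiplied by - e^(d t) when a grows by d,
so that a geometric sum gives H(t) (e^(w d t) + 1) for this series, which is the
exponential generating function of the power sums T_m(w d - 1, χ).  Hence the triple
sum for (w₁, w₂, w₃) is n! times the coefficient of t^n in

  4 e^(W y₁ t) e^(W y₂ t) (e^(W d t) + 1) H(w₂ w₃ t) H(w₁ w₃ t) H(w₁ w₂ t),   W = w₁ w₂ w₃,

which is symmetric in w₁, w₂, w₃.
-}
module Submission where

open import Defs
open import Algebra.Apartness.Bundles using (HeytingField; module HeytingCommutativeRing)
open import Algebra.Bundles using (CommutativeRing; module CommutativeRing)
open import Algebra.Bundles.Raw using (RawRing; module RawRing)
open import Algebra.Morphism.Structures using (module RingMorphisms)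
import Algebra.Properties.CommutativeSemiring.Binomial as Binomial
import Algebra.Properties.CommutativeSemiring.Exp as CommutativeSemiringExp
import Algebra.Properties.Ring as RingProperties
import Algebra.Properties.Semiring.Mult as SemiringMult
import Algebra.Solver.Ring.NaturalCoefficients.Default as SemiringSolver
open import Data.Integer.Base using (+_)
import Data.Integer.Base as ℤ
import Data.Integer.Divisibility.Signed as ℤ
open import Data.Integer.Tactic.RingSolver using (solve-∀)
open import Data.List.Base using ([]; _∷_; [_]; map)
open import Data.Nat.Base using (ℕ; zero; suc; _∸_; _<_; _≤_; z<s; s<s; s≤s⁻¹; _!; NonZero)
import Data.Nat.Base as ℕ
open import Data.Nat.Combinatorics using (_C_; k![n∸k]!∣n!; nCk≡n!/k![n-k]!)
import Data.Nat.Divisibility as ℕ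
open import Data.Nat.DivMod using (m/n*n≡m)
open import Data.Nat.Primality using (Prime)
import Data.Nat.Properties as ℕ
open import Data.Nat.Properties using (_!≢0; _!*_!≢0; m*n≢0)
open import Data.Product.Base using (_×_; _,_; proj₁; proj₂)
open import Function.Base using (_∘_)
open import Level using (Level; _⊔_)
open import Relation.Binary.PropositionalEquality using (_≡_)
import Relation.Binary.PropositionalEquality as ≡
import Relation.Binary.Reasoning.Setoid as SetoidReasoning
open import Relation.Nullary.Negation using (contradiction)

-- The weights regroup as w₁^(l+m) w₂^(k+m) w₃^(k+l) = (w₂ w₃)^k (w₁ w₃)^l (w₁ w₂)^m, so each of the
-- three series undergoes its own substitution t ↦ w_i w_j t. This turns w₁ y₁, w₂ y₂ and w₃ d alike
-- into multiples of W: no y stays tied to a particular w. The power sum series supplies the third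
-- copy of H, without which the product would not be symmetric.
--
-- The obstacle is that E_{n,χ} is a list of coefficients, read off from a long division in K[x]⟦t⟧,
-- where lists that differ by trailing zeros count as equal. Instead of establishing the ring laws
-- for such lists, x is evaluated at y at the outset. Evaluation respects the raw operations, hence
-- also long division, and lands in K⟦t⟧, the only series ring in which algebra is done.

private variable
  c ℓ c′ ℓ′ ℓ₂ : Level

-- Parity, and factorial forms of binomial and multinomial coefficients.

Odd-pred₂ : ∀ {n} → Odd (suc (suc n)) → Odd n
Odd-pred₂ odd 2∣n = odd (ℕ.∣m∣n⇒∣m+n (ℕ.divides-refl 1) 2∣n)

Odd⇒NonZero : ∀ {n} → Odd n → NonZero n
Odd⇒NonZero {zero}  odd = contradiction (2 ℕ.∣0) odd
Odd⇒NonZero {suc n} odd = _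

nCk*k![n∸k]!≡n! : ∀ {n k} → k ≤ n → (n C k) ℕ.* (k ! ℕ.* (n ∸ k) !) ≡ n !
nCk*k![n∸k]!≡n! {n} {k} k≤n = ≡.trans (≡.cong (ℕ._* (k ! ℕ.* (n ∸ k) !)) (nCk≡n!/k![n-k]! k≤n))
  (m/n*n≡m (k![n∸k]!∣n! k≤n))
  where instance _ = k !* (n ∸ k) !≢0

-- The division in `multinomial` truncates, so divisibility has to be shown: l! m! divides (n - k)!,
-- and k! (n - k)! divides n!.
multinomial-! : ∀ {n k l} → k ≤ n → l ≤ n ∸ k → let m = n ∸ k ∸ l in
                multinomial n k l m ℕ.* (k ! ℕ.* l ! ℕ.* m !) ≡ n !
multinomial-! {n} {k} {l} k≤n l≤n∸k = m/n*n≡m (ℕ.∣-trans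
  (≡.subst (ℕ._∣ k ! ℕ.* (n ∸ k) !) (≡.sym (ℕ.*-assoc (k !) (l !) _))
    (ℕ.*-monoʳ-∣ (k !) (k![n∸k]!∣n! l≤n∸k)))
  (k![n∸k]!∣n! k≤n))
  where
  m = n ∸ k ∸ l
  instance _ = m*n≢0 (k ! ℕ.* l !) (m !) {{m*n≢0 (k !) (l !) {{k !≢0}} {{l !≢0}}}} {{m !≢0}}

-- Finite sums and the alternating geometric sum in a commutative ring.

module RingLemmas (R : CommutativeRing c ℓ) where
  open CommutativeRing R renaming (rawRing to R-raw)
  open RingOperations R-raw using (_^_; sum<; fromℕ) renaming (_·_ to _•_)
  open SetoidReasoning setoid
  open RingProperties ring using (-‿distribˡ-*; -‿distribʳ-*; -‿involutive)
  open SemiringMult semiring using (×-assoc-*; ×-congʳ)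
  open SemiringSolver commutativeSemiring

  sum<-cong : ∀ n {f g} → (∀ i → i < n → f i ≈ g i) → sum< n f ≈ sum< n g
  sum<-cong zero    f≈g = refl
  sum<-cong (suc n) f≈g = +-cong (f≈g 0 z<s) (sum<-cong n (λ i i<n → f≈g (suc i) (s<s i<n)))

  sum<-distribˡ : ∀ n a f → a * sum< n f ≈ sum< n (λ i → a * f i)
  sum<-distribˡ zero    a f = zeroʳ a
  sum<-distribˡ (suc n) a f = trans (distribˡ a _ _) (+-congˡ (sum<-distribˡ n a (f ∘ suc)))

  sum<-+ : ∀ m n f → sum< (m ℕ.+ n) f ≈ sum< m f + sum< n (λ i → f (m ℕ.+ i))
  sum<-+ zero    n f = sym (+-identityˡ _)
  sum<-+ (suc m) n f = trans (+-congˡ (sum<-+ m n (f ∘ suc))) (sym (+-assoc _ _ _))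

  •≈fromℕ* : ∀ n x → n • x ≈ fromℕ n * x
  •≈fromℕ* n x = trans (sym (×-congʳ n (*-identityˡ x))) (sym (×-assoc-* n 1# x))

  [-x]*[-y]≈x*y : ∀ x y → - x * - y ≈ x * y
  [-x]*[-y]≈x*y x y = begin
    - x * - y      ≈⟨ -‿distribˡ-* x (- y) ⟨
    - (x * - y)    ≈⟨ -‿cong (-‿distribʳ-* x y) ⟨
    - - (x * y)    ≈⟨ -‿involutive _ ⟩
    x * y          ∎

  -- `Odd` is a negated divisibility with no structure of its own, so the recursion goes in steps of
  -- two, in which two signs cancel.
  -‿^-odd : ∀ {n} → Odd n → ∀ x → (- x) ^ n ≈ - (x ^ n)
  -‿^-odd {zero}        odd x = contradiction (2 ℕ.∣0) odd
  -‿^-odd {suc zero}    odd x = sym (-‿distribˡ-* x 1#)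
  -‿^-odd {suc (suc n)} odd x = begin
    - x * (- x * (- x) ^ n)  ≈⟨ *-assoc _ _ _ ⟨
    - x * - x * (- x) ^ n    ≈⟨ *-cong ([-x]*[-y]≈x*y x x) (-‿^-odd (Odd-pred₂ odd) x) ⟩
    x * x * - (x ^ n)        ≈⟨ -‿distribʳ-* _ _ ⟨
    - (x * x * x ^ n)        ≈⟨ -‿cong (*-assoc _ _ _) ⟩
    - (x * (x * x ^ n))      ∎

  module _ (d : ℕ) (x : Carrier) (f : ℕ → Carrier) (f-shift : ∀ a → f (d ℕ.+ a) ≈ - x * f a) where

    -- The j blocks of length d form a geometric progression of ratio - x, and x + 1 is 1 minus that
    -- ratio. The induction splits off the first block; the remaining ones are - x times the sum for
    -- j.
    sum<-*-geometric : ∀ j → sum< (j ℕ.* d) f * (x + 1#) ≈ sum< d f * (1# - (- x) ^ j)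
    sum<-*-geometric zero    = begin
      0# * (x + 1#)         ≈⟨ zeroˡ _ ⟩
      0#                    ≈⟨ zeroʳ _ ⟨
      sum< d f * 0#         ≈⟨ *-congˡ (-‿inverseʳ 1#) ⟨
      sum< d f * (1# - 1#)  ∎
    sum<-*-geometric (suc j) = begin
      sum< (d ℕ.+ j ℕ.* d) f * (x + 1#)
        ≈⟨ *-congʳ (sum<-+ d (j ℕ.* d) f) ⟩
      (s + sum< (j ℕ.* d) (λ a → f (d ℕ.+ a))) * (x + 1#)
        ≈⟨ *-congʳ (+-congˡ (sum<-cong (j ℕ.* d) (λ a _ → f-shift a))) ⟩
      (s + sum< (j ℕ.* d) (λ a → - x * f a)) * (x + 1#)
        ≈⟨ *-congʳ (+-congˡ (sum<-distribˡ (j ℕ.* d) (- x) f)) ⟨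
      (s + - x * sum< (j ℕ.* d) f) * (x + 1#)
        ≈⟨ solve 4 (λ s y b z → (s :+ y :* b) :* z := s :* z :+ y :* (b :* z)) refl
             s (- x) (sum< (j ℕ.* d) f) (x + 1#) ⟩
      s * (x + 1#) + - x * (sum< (j ℕ.* d) f * (x + 1#))
        ≈⟨ +-congˡ (*-congˡ (sum<-*-geometric j)) ⟩
      s * (x + 1#) + - x * (s * (1# - p))
        -- The solver is for semirings: - x and - p enter as unrelated atoms, and x + - x is
        -- gathered so that it can be cancelled afterwards.
        ≈⟨ solve 4 (λ s x y q → s :* (x :+ con 1) :+ y :* (s :* (con 1 :+ q))
                             := s :* (con 1 :+ y :* q :+ (x :+ y))) refl s x (- x) (- p) ⟩
      s * (1# + - x * - p + (x - x))
        ≈⟨ *-congˡ (+-cong (+-congˡ (sym (-‿distribʳ-* (- x) p))) (-‿inverseʳ x)) ⟩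
      s * (1# - - x * p + 0#)
        ≈⟨ *-congˡ (+-identityʳ _) ⟩
      s * (1# - - x * p) ∎
      where
      s = sum< d f
      p = (- x) ^ j

    sum<-*-odd : ∀ {j} → Odd j → sum< (j ℕ.* d) f * (x + 1#) ≈ sum< d f * (x ^ j + 1#)
    sum<-*-odd {j} odd = begin
      sum< (j ℕ.* d) f * (x + 1#)   ≈⟨ sum<-*-geometric j ⟩
      sum< d f * (1# - (- x) ^ j)   ≈⟨ *-congˡ (+-congˡ (-‿cong (-‿^-odd odd x))) ⟩
      sum< d f * (1# - - (x ^ j))   ≈⟨ *-congˡ (+-congˡ (-‿involutive _)) ⟩
      sum< d f * (1# + x ^ j)       ≈⟨ *-congˡ (+-comm _ _) ⟩
      sum< d f * (x ^ j + 1#)       ∎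

-- Unlike the ring homomorphisms of the standard library, these need not respect
-- the equality of the source.
record RawRingHomomorphism (A : RawRing c ℓ) (B : CommutativeRing c′ ℓ′) : Set (c ⊔ c′ ⊔ ℓ′) where
  private
    module A = RingOperations A
    module B = CommutativeRing B
    module B′ = RingOperations B.rawRing
  field
    ⟦_⟧    : A.Carrier → B.Carrier
    +-homo : ∀ x y → ⟦ x A.+ y ⟧ B.≈ ⟦ x ⟧ B.+ ⟦ y ⟧
    *-homo : ∀ x y → ⟦ x A.* y ⟧ B.≈ ⟦ x ⟧ B.* ⟦ y ⟧
    -‿homo : ∀ x → ⟦ A.- x ⟧ B.≈ B.- ⟦ x ⟧
    0-homo : ⟦ A.0# ⟧ B.≈ B.0#
    1-homo : ⟦ A.1# ⟧ B.≈ B.1#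

  ^-homo : ∀ x n → ⟦ x A.^ n ⟧ B.≈ ⟦ x ⟧ B′.^ n
  ^-homo x zero    = 1-homo
  ^-homo x (suc n) = B.trans (*-homo x _) (B.*-congˡ (^-homo x n))

  ·-homo : ∀ n x → ⟦ n A.· x ⟧ B.≈ n B′.· ⟦ x ⟧
  ·-homo zero    x = 0-homo
  ·-homo (suc n) x = B.trans (+-homo x _) (B.+-congˡ (·-homo n x))

  fromℕ-homo : ∀ n → ⟦ A.fromℕ n ⟧ B.≈ B′.fromℕ n
  fromℕ-homo zero    = 0-homo
  fromℕ-homo (suc n) = B.trans (+-homo _ _) (B.+-cong 1-homo (fromℕ-homo n))

  sum<-homo : ∀ n f → ⟦ A.sum< n f ⟧ B.≈ B′.sum< n (λ i → ⟦ f i ⟧)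
  sum<-homo zero    f = 0-homo
  sum<-homo (suc n) f = B.trans (+-homo _ _) (B.+-congˡ (sum<-homo n (f ∘ suc)))

-- Power series

module SeriesRing (R : CommutativeRing c ℓ) where
  open CommutativeRing R renaming (rawRing to R-raw)
  open PowerSeries R-raw using (Series; constant; seriesRing; quotient) public
  open RingOperations R-raw using (_^_; sum<)
  private module S = RingOperations seriesRing
  open SetoidReasoning setoid
  open RingProperties ring using (-0#≈0#; -‿distribʳ-*)
  open SemiringSolver commutativeSemiring
  open CommutativeSemiringExp commutativeSemiring using (^-congˡ)

  private
    -- By definition (f * g) (n + 1) is f 0 * g (n + 1) + (tail f * g) n, as a sum peels off its
    -- first summand. The ring laws below are inductions on the index along this equation.
    tail : Series → Series
    tail f = f ∘ suc

    _▹_ : Carrier → Series → Series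
    (a ▹ f) n = a * f n

    *-cong′ : ∀ {f f′ g g′} → f S.≈ f′ → g S.≈ g′ → f S.* g S.≈ f′ S.* g′
    *-cong′ f≈ g≈ zero    = +-congʳ (*-cong (f≈ 0) (g≈ 0))
    *-cong′ f≈ g≈ (suc n) = +-cong (*-cong (f≈ 0) (g≈ (suc n))) (*-cong′ (f≈ ∘ suc) g≈ n)

    *-zeroˡ : ∀ f n → ((λ _ → 0#) S.* f) n ≈ 0#
    *-zeroˡ f zero    = trans (+-identityʳ _) (zeroˡ _)
    *-zeroˡ f (suc n) = trans (+-cong (zeroˡ _) (*-zeroˡ f n)) (+-identityˡ 0#)

    ▹-* : ∀ a f g → (a ▹ f) S.* g S.≈ a ▹ (f S.* g)
    ▹-* a f g zero    = solve 3 (λ a x y → a :* x :* y :+ con 0 := a :* (x :* y :+ con 0)) refl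
                          a (f 0) (g 0)
    ▹-* a f g (suc n) = begin
      a * f 0 * g (suc n) + ((a ▹ tail f) S.* g) n  ≈⟨ +-cong (*-assoc _ _ _) (▹-* a (tail f) g n) ⟩
      a * (f 0 * g (suc n)) + a * (tail f S.* g) n  ≈⟨ distribˡ _ _ _ ⟨
      a * (f 0 * g (suc n) + (tail f S.* g) n)      ∎

    *-distribʳ : ∀ h f g → (f S.+ g) S.* h S.≈ f S.* h S.+ g S.* h
    *-distribʳ h f g zero    =
      solve 3 (λ x y z → (x :+ y) :* z :+ con 0 := (x :* z :+ con 0) :+ (y :* z :+ con 0)) refl
        (f 0) (g 0) (h 0)
    *-distribʳ h f g (suc n) = begin
      (f 0 + g 0) * h (suc n) + ((tail f S.+ tail g) S.* h) n
        ≈⟨ +-congˡ (*-distribʳ h (tail f) (tail g) n) ⟩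
      (f 0 + g 0) * h (suc n) + ((tail f S.* h) n + (tail g S.* h) n)
        ≈⟨ solve 5 (λ x y z p q → (x :+ y) :* z :+ (p :+ q) := (x :* z :+ p) :+ (y :* z :+ q)) refl
             (f 0) (g 0) (h (suc n)) ((tail f S.* h) n) ((tail g S.* h) n) ⟩
      (f S.* h) (suc n) + (g S.* h) (suc n) ∎

    -- The product unfolds on its left factor only. Three appeals to commutativity at smaller
    -- indices expose both outer terms, with `tail f S.* tail g` in the middle; the index drops by
    -- up to two, hence two base cases.
    *-comm′ : ∀ f g → f S.* g S.≈ g S.* f
    *-comm′ f g zero       = +-congʳ (*-comm _ _)
    *-comm′ f g (suc zero) =
      solve 4 (λ f₀ f₁ g₀ g₁ → f₀ :* g₁ :+ (f₁ :* g₀ :+ con 0) := g₀ :* f₁ :+ (g₁ :* f₀ :+ con 0)) refl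
        (f 0) (f 1) (g 0) (g 1)
    *-comm′ f g (suc (suc n)) = begin
      f 0 * g (2 ℕ.+ n) + (tail f S.* g) (suc n)
        ≈⟨ +-congˡ (*-comm′ (tail f) g (suc n)) ⟩
      f 0 * g (2 ℕ.+ n) + (g 0 * f (2 ℕ.+ n) + (tail g S.* tail f) n)
        ≈⟨ +-congˡ (+-congˡ (*-comm′ (tail g) (tail f) n)) ⟩
      f 0 * g (2 ℕ.+ n) + (g 0 * f (2 ℕ.+ n) + (tail f S.* tail g) n)
        ≈⟨ solve 3 (λ p q r → p :+ (q :+ r) := q :+ (p :+ r)) refl _ _ _ ⟩
      g 0 * f (2 ℕ.+ n) + (f S.* tail g) (suc n)
        ≈⟨ +-congˡ (*-comm′ f (tail g) (suc n)) ⟩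
      g 0 * f (2 ℕ.+ n) + (tail g S.* f) (suc n) ∎

    *-assoc′ : ∀ f g h → (f S.* g) S.* h S.≈ f S.* (g S.* h)
    *-assoc′ f g h zero    =
      solve 3 (λ x y z → (x :* y :+ con 0) :* z :+ con 0 := x :* (y :* z :+ con 0) :+ con 0) refl
        (f 0) (g 0) (h 0)
    *-assoc′ f g h (suc n) = begin
      -- The tail of `f S.* g` is, by definition, `f 0 ▹ tail g S.+ tail f S.* g`.
      (f 0 * g 0 + 0#) * h (suc n) + ((f 0 ▹ tail g S.+ tail f S.* g) S.* h) n
        ≈⟨ +-cong (*-congʳ (+-identityʳ _)) (*-distribʳ h (f 0 ▹ tail g) (tail f S.* g) n) ⟩
      f 0 * g 0 * h (suc n) + (((f 0 ▹ tail g) S.* h) n + ((tail f S.* g) S.* h) n)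
        ≈⟨ +-congˡ (+-cong (▹-* (f 0) (tail g) h n) (*-assoc′ (tail f) g h n)) ⟩
      f 0 * g 0 * h (suc n) + (f 0 * (tail g S.* h) n + (tail f S.* (g S.* h)) n)
        ≈⟨ solve 5 (λ x y z p q → x :* y :* z :+ (x :* p :+ q) := x :* (y :* z :+ p) :+ q) refl
             (f 0) (g 0) (h (suc n)) _ _ ⟩
      f 0 * (g 0 * h (suc n) + (tail g S.* h) n) + (tail f S.* (g S.* h)) n ∎

  constant-* : ∀ a f → constant a S.* f S.≈ (λ n → a * f n)
  constant-* a f zero    = +-identityʳ _
  constant-* a f (suc n) = trans (+-congˡ (*-zeroˡ f n)) (+-identityʳ _)

  private
    *-identityˡ′ : ∀ f → S.1# S.* f S.≈ f
    *-identityˡ′ f n = trans (constant-* 1# f n) (*-identityˡ (f n))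

    0-apply : ∀ n → S.0# n ≈ 0#
    0-apply zero    = refl
    0-apply (suc n) = refl

    *-distribˡ : ∀ h f g → h S.* (f S.+ g) S.≈ h S.* f S.+ h S.* g
    *-distribˡ h f g n = begin
      (h S.* (f S.+ g)) n        ≈⟨ *-comm′ h (f S.+ g) n ⟩
      ((f S.+ g) S.* h) n        ≈⟨ *-distribʳ h f g n ⟩
      (f S.* h S.+ g S.* h) n    ≈⟨ +-cong (*-comm′ f h n) (*-comm′ g h n) ⟩
      (h S.* f S.+ h S.* g) n    ∎

  seriesCommutativeRing : CommutativeRing c ℓ
  seriesCommutativeRing = record
    { RawRing seriesRing
    ; isCommutativeRing = record
      { isRing = record
        { +-isAbelianGroup = record
          { isGroup = record
            { isMonoid = record
              { isSemigroup = record
                { isMagma = record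
                  { isEquivalence = record
                    { refl  = λ _ → refl
                    ; sym   = λ f≈g n → sym (f≈g n)
                    ; trans = λ f≈g g≈h n → trans (f≈g n) (g≈h n)
                    }
                  ; ∙-cong = λ f≈ g≈ n → +-cong (f≈ n) (g≈ n)
                  }
                ; assoc = λ f g h n → +-assoc _ _ _
                }
              ; identity = (λ f n → trans (+-congʳ (0-apply n)) (+-identityˡ _))
                         , (λ f n → trans (+-congˡ (0-apply n)) (+-identityʳ _))
              }
            ; inverse = (λ f n → trans (-‿inverseˡ _) (sym (0-apply n)))
                      , (λ f n → trans (-‿inverseʳ _) (sym (0-apply n)))
            ; ⁻¹-cong = λ f≈g n → -‿cong (f≈g n)
            }
          ; comm = λ f g n → +-comm _ _
          }
        ; *-cong     = *-cong′
        ; *-assoc    = *-assoc′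
        ; *-identity = *-identityˡ′ , (λ f n → trans (*-comm′ f S.1# n) (*-identityˡ′ f n))
        ; distrib    = *-distribˡ , *-distribʳ
        }
      ; *-comm = *-comm′
      }
    }

  constant-cong : ∀ {a b} → a ≈ b → constant a S.≈ constant b
  constant-cong a≈b zero    = a≈b
  constant-cong a≈b (suc n) = refl

  constantHomomorphism : RawRingHomomorphism R-raw seriesCommutativeRing
  constantHomomorphism = record
    { ⟦_⟧    = constant
    ; +-homo = λ { x y zero → refl ; x y (suc n) → sym (+-identityˡ 0#) }
    ; *-homo = λ { x y zero → sym (constant-* x (constant y) 0)
                 ; x y (suc n) → sym (trans (constant-* x (constant y) (suc n)) (zeroʳ x)) }
    ; -‿homo = λ { x zero → refl ; x (suc n) → sym -0#≈0# }
    ; 0-homo = λ _ → refl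
    ; 1-homo = λ _ → refl
    }

  sum<-apply : ∀ m f n → S.sum< m f n ≈ sum< m (λ i → f i n)
  sum<-apply zero    f n = 0-apply n
  sum<-apply (suc m) f n = +-congˡ (sum<-apply m (f ∘ suc) n)

  -- The substitution t ↦ a t.
  scale : Carrier → Series → Series
  scale a f n = a ^ n * f n

  scale-cong : ∀ {a b f g} → a ≈ b → f S.≈ g → scale a f S.≈ scale b g
  scale-cong a≈b f≈g n = *-cong (^-congˡ n a≈b) (f≈g n)

  private
    scale-* : ∀ a f g → scale a (f S.* g) S.≈ scale a f S.* scale a g
    scale-* a f g zero    = solve 2 (λ x y → con 1 :* (x :* y :+ con 0)
                                          := con 1 :* x :* (con 1 :* y) :+ con 0) refl (f 0) (g 0)
    scale-* a f g (suc n) = begin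
      a * a ^ n * (f 0 * g (suc n) + (tail f S.* g) n)
        ≈⟨ solve 5 (λ a p x y z → a :* p :* (x :* y :+ z)
                               := con 1 :* x :* (a :* p :* y) :+ a :* (p :* z)) refl
             a (a ^ n) (f 0) (g (suc n)) ((tail f S.* g) n) ⟩
      1# * f 0 * (a * a ^ n * g (suc n)) + a * (a ^ n * (tail f S.* g) n)
        ≈⟨ +-congˡ (*-congˡ (scale-* a (tail f) g n)) ⟩
      1# * f 0 * (a * a ^ n * g (suc n)) + a * (scale a (tail f) S.* scale a g) n
        ≈⟨ +-congˡ (▹-* a (scale a (tail f)) (scale a g) n) ⟨
      1# * f 0 * (a * a ^ n * g (suc n)) + ((a ▹ scale a (tail f)) S.* scale a g) n
        ≈⟨ +-congˡ (*-cong′ {g = scale a g} (λ i → sym (*-assoc a (a ^ i) (f (suc i)))) (λ _ → refl) n) ⟩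
      1# * f 0 * (a * a ^ n * g (suc n)) + (tail (scale a f) S.* scale a g) n ∎

    scale-constant : ∀ a b → scale a (constant b) S.≈ constant b
    scale-constant a b zero    = *-identityˡ b
    scale-constant a b (suc n) = zeroʳ _

  scaleHomomorphism : Carrier → RawRingHomomorphism seriesRing seriesCommutativeRing
  scaleHomomorphism a = record
    { ⟦_⟧    = scale a
    ; +-homo = λ f g n → distribˡ _ _ _
    ; *-homo = scale-* a
    ; -‿homo = λ f n → sym (-‿distribʳ-* _ _)
    ; 0-homo = scale-constant a 0#
    ; 1-homo = scale-constant a 1#
    }

  quotient-cong : ∀ {f f′ g g′ u u′} → f S.≈ f′ → g S.≈ g′ → u ≈ u′ →
                  quotient f g u S.≈ quotient f′ g′ u′
  quotient-cong f≈ g≈ u≈ zero    = *-cong u≈ (f≈ 0)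
  quotient-cong f≈ g≈ u≈ (suc n) = quotient-cong
    (λ i → +-cong (f≈ (suc i)) (-‿cong (*-cong (*-cong u≈ (f≈ 0)) (g≈ (suc i))))) g≈ u≈ n

  -- The recursive call divides (f - u f₀ g) / t, so the induction on the index lets the dividend
  -- vary. What was subtracted from the coefficient is exactly the first summand of the product.
  quotient-* : ∀ f g u → u * g 0 ≈ 1# → quotient f g u S.* g S.≈ f
  quotient-* f g u ug₀≈1 zero    = begin
    u * f 0 * g 0 + 0#  ≈⟨ solve 3 (λ u x y → u :* x :* y :+ con 0 := u :* y :* x) refl u (f 0) (g 0) ⟩
    u * g 0 * f 0       ≈⟨ *-congʳ ug₀≈1 ⟩
    1# * f 0            ≈⟨ *-identityˡ _ ⟩
    f 0                 ∎
  quotient-* f g u ug₀≈1 (suc n) = begin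
    q + (quotient f′ g u S.* g) n
      ≈⟨ +-congˡ (quotient-* f′ g u ug₀≈1 n) ⟩
    q + (f (suc n) - q)
      ≈⟨ solve 3 (λ q x r → q :+ (x :+ r) := x :+ (q :+ r)) refl q (f (suc n)) (- q) ⟩
    f (suc n) + (q - q)  ≈⟨ +-congˡ (-‿inverseʳ q) ⟩
    f (suc n) + 0#       ≈⟨ +-identityʳ _ ⟩
    f (suc n)            ∎
    where
    q  = u * f 0 * g (suc n)
    f′ = λ i → f (suc i) - u * f 0 * g (suc i)

-- Homomorphisms applied to power series coefficient by coefficient.

module SeriesMap {A : RawRing c ℓ} {B : CommutativeRing c′ ℓ′} (φ : RawRingHomomorphism A B) where
  private
    module A = PowerSeries A
    module B where
      open CommutativeRing B public
      open SeriesRing B public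
    module φ = RawRingHomomorphism φ
    open φ using (⟦_⟧)

  constant-homo : ∀ a n → ⟦ A.constant a n ⟧ B.≈ B.constant ⟦ a ⟧ n
  constant-homo a zero    = B.refl
  constant-homo a (suc n) = φ.0-homo

  seriesMap : RawRingHomomorphism A.seriesRing B.seriesCommutativeRing
  seriesMap = record
    { ⟦_⟧    = λ f n → ⟦ f n ⟧
    ; +-homo = λ f g n → φ.+-homo _ _
    ; *-homo = λ f g n → B.trans (φ.sum<-homo (suc n) (λ i → RawRing._*_ A (f i) (g (n ∸ i))))
                           (RingLemmas.sum<-cong B (suc n) (λ i _ → φ.*-homo (f i) (g (n ∸ i))))
    ; -‿homo = λ f n → φ.-‿homo _
    ; 0-homo = λ n → B.trans (constant-homo _ n) (B.constant-cong φ.0-homo n)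
    ; 1-homo = λ n → B.trans (constant-homo _ n) (B.constant-cong φ.1-homo n)
    }

  -- Each step of long division is a ring expression in the dividend, the divisor and u, so a
  -- homomorphism passes through it.
  quotient-homo : ∀ f g u n → ⟦ A.quotient f g u n ⟧ B.≈
                  B.quotient (λ i → ⟦ f i ⟧) (λ i → ⟦ g i ⟧) ⟦ u ⟧ n
  quotient-homo f g u zero    = φ.*-homo _ _
  quotient-homo f g u (suc n) = B.trans (quotient-homo f′ g u n) (B.quotient-cong
    (λ i → B.trans (φ.+-homo _ _) (B.+-congˡ (B.trans (φ.-‿homo _) (B.-‿cong
             (B.trans (φ.*-homo _ _) (B.*-congʳ (φ.*-homo _ _)))))))
    (λ _ → B.refl) B.refl n)
    where
    open RawRing A using (_+_; _*_; -_)
    f′ = λ i → f (suc i) + - (u * f 0 * g (suc i))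

-- Evaluation of polynomials

module Evaluation (R : CommutativeRing c ℓ) where
  open CommutativeRing R renaming (rawRing to R-raw)
  open Polynomials R-raw
  open SemiringSolver commutativeSemiring
  open SetoidReasoning setoid
  open RingProperties ring using (-0#≈0#; -‿+-comm; -‿distribʳ-*)

  module _ (x : Carrier) where

    evaluate-[] : ∀ a → evaluate [ a ] x ≈ a
    evaluate-[] a = trans (+-congˡ (zeroʳ x)) (+-identityʳ a)

    evaluate-X : evaluate X x ≈ x
    evaluate-X = solve 1 (λ x → con 0 :+ x :* (con 1 :+ x :* con 0) := x) refl x

    private
      evaluate-⊕ : ∀ p q → evaluate (p ⊕ q) x ≈ evaluate p x + evaluate q x
      evaluate-⊕ []      q       = sym (+-identityˡ _)
      evaluate-⊕ (a ∷ p) []      = sym (+-identityʳ _)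
      evaluate-⊕ (a ∷ p) (b ∷ q) = begin
        a + b + x * evaluate (p ⊕ q) x
          ≈⟨ +-congˡ (*-congˡ (evaluate-⊕ p q)) ⟩
        a + b + x * (evaluate p x + evaluate q x)
          ≈⟨ solve 5 (λ a b x p q → a :+ b :+ x :* (p :+ q) := a :+ x :* p :+ (b :+ x :* q)) refl
               a b x (evaluate p x) (evaluate q x) ⟩
        a + x * evaluate p x + (b + x * evaluate q x) ∎

      evaluate-map-* : ∀ a p → evaluate (map (a *_) p) x ≈ a * evaluate p x
      evaluate-map-* a []      = sym (zeroʳ a)
      evaluate-map-* a (b ∷ p) = begin
        a * b + x * evaluate (map (a *_) p) x
          ≈⟨ +-congˡ (*-congˡ (evaluate-map-* a p)) ⟩
        a * b + x * (a * evaluate p x)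
          ≈⟨ solve 4 (λ a b x p → a :* b :+ x :* (a :* p) := a :* (b :+ x :* p)) refl
               a b x (evaluate p x) ⟩
        a * (b + x * evaluate p x) ∎

      evaluate-⊗ : ∀ p q → evaluate (p ⊗ q) x ≈ evaluate p x * evaluate q x
      evaluate-⊗ []      q = sym (zeroˡ _)
      evaluate-⊗ (a ∷ p) q = begin
        evaluate (map (a *_) q ⊕ (0# ∷ (p ⊗ q))) x
          ≈⟨ evaluate-⊕ (map (a *_) q) (0# ∷ (p ⊗ q)) ⟩
        evaluate (map (a *_) q) x + (0# + x * evaluate (p ⊗ q) x)
          ≈⟨ +-cong (evaluate-map-* a q) (+-congˡ (*-congˡ (evaluate-⊗ p q))) ⟩
        a * evaluate q x + (0# + x * (evaluate p x * evaluate q x))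
          ≈⟨ solve 4 (λ a x p q → a :* q :+ (con 0 :+ x :* (p :* q)) := (a :+ x :* p) :* q) refl
               a x (evaluate p x) (evaluate q x) ⟩
        (a + x * evaluate p x) * evaluate q x ∎

      evaluate-neg : ∀ p → evaluate (map -_ p) x ≈ - evaluate p x
      evaluate-neg []      = sym -0#≈0#
      evaluate-neg (a ∷ p) = begin
        - a + x * evaluate (map -_ p) x  ≈⟨ +-congˡ (*-congˡ (evaluate-neg p)) ⟩
        - a + x * - evaluate p x         ≈⟨ +-congˡ (-‿distribʳ-* x _) ⟨
        - a - x * evaluate p x           ≈⟨ -‿+-comm a _ ⟩
        - (a + x * evaluate p x)         ∎

    evaluateHomomorphism : RawRingHomomorphism polynomialRing R
    evaluateHomomorphism = record
      { ⟦_⟧    = λ p → evaluate p x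
      ; +-homo = evaluate-⊕
      ; *-homo = evaluate-⊗
      ; -‿homo = evaluate-neg
      ; 0-homo = refl
      ; 1-homo = evaluate-[] 1#
      }

-- Exponential series

-- The form in which characteristic zero enters the series argument. As 2! = 2, `inv! 2` also serves
-- as the inverse of 2.
record InverseFactorials (R : CommutativeRing c ℓ) : Set (c ⊔ ℓ) where
  open CommutativeRing R using (Carrier; _≈_; _*_; 1#)
  field
    inv!         : ℕ → Carrier
    inv!-inverse : ∀ n → inv! n * RingOperations.fromℕ (CommutativeRing.rawRing R) (n !) ≈ 1#

module Exponential (R : CommutativeRing c ℓ) (inverseFactorials : InverseFactorials R) where
  open CommutativeRing R renaming (rawRing to R-raw)
  open InverseFactorials inverseFactorials
  open RingOperations R-raw using (_^_; sum<; fromℕ) renaming (_·_ to _•_)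
  open RingLemmas R using (sum<-cong; sum<-distribˡ; •≈fromℕ*)
  open SeriesRing R
  private
    module S = CommutativeRing seriesCommutativeRing
    module S′ = RingOperations seriesRing
  open CommutativeSemiringExp commutativeSemiring using (^-congˡ; ^-distrib-*)
  open SemiringMult semiring using (×1-homo-*; ×-homo-+)
  open SemiringSolver commutativeSemiring
  open SetoidReasoning setoid

  fromℕ-! : ∀ M {k m n} → M ℕ.* (k ! ℕ.* m !) ≡ n ! →
            fromℕ (n !) ≈ fromℕ M * (fromℕ (k !) * fromℕ (m !))
  fromℕ-! M {k} {m} {n} eq = begin
    fromℕ (n !)                              ≡⟨ ≡.cong fromℕ eq ⟨
    fromℕ (M ℕ.* (k ! ℕ.* m !))              ≈⟨ ×1-homo-* M _ ⟩
    fromℕ M * fromℕ (k ! ℕ.* m !)            ≈⟨ *-congˡ (×1-homo-* (k !) (m !)) ⟩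
    fromℕ M * (fromℕ (k !) * fromℕ (m !))    ∎

  -- The factor 1 is inserted as `inv! n` times n!; writing n! as (n C k) k! (n - k)! then cancels
  -- both inverses on the left. This brings exponential products to the binomial theorem.
  inv!-* : ∀ {n k} → k ≤ n → inv! k * inv! (n ∸ k) ≈ inv! n * fromℕ (n C k)
  inv!-* {n} {k} k≤n = begin
    inv! k * inv! m
      ≈⟨ solve 2 (λ x y → x :* y := con 1 :* (x :* y)) refl _ _ ⟩
    1# * (inv! k * inv! m)
      ≈⟨ *-congʳ (inv!-inverse n) ⟨
    inv! n * fromℕ (n !) * (inv! k * inv! m)
      ≈⟨ *-congʳ (*-congˡ (fromℕ-! (n C k) {k} {m} {n} (nCk*k![n∸k]!≡n! k≤n))) ⟩
    inv! n * (b * (fromℕ (k !) * fromℕ (m !))) * (inv! k * inv! m)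
      ≈⟨ solve 6 (λ i b k m k′ m′ → i :* (b :* (k :* m)) :* (k′ :* m′)
                                 := i :* b :* ((k′ :* k) :* (m′ :* m))) refl
           (inv! n) b (fromℕ (k !)) (fromℕ (m !)) (inv! k) (inv! m) ⟩
    inv! n * b * ((inv! k * fromℕ (k !)) * (inv! m * fromℕ (m !)))
      ≈⟨ *-congˡ (*-cong (inv!-inverse k) (inv!-inverse m)) ⟩
    inv! n * b * (1# * 1#)
      ≈⟨ solve 1 (λ x → x :* (con 1 :* con 1) := x) refl _ ⟩
    inv! n * b ∎
    where
    m = n ∸ k
    b = fromℕ (n C k)

  -- The asymmetry fits its use: k! and l! are absorbed by the Euler values, which are factorials
  -- times coefficients, while the coefficient of the power sum series comes with `inv! m`.
  multinomial-inv! : ∀ {n k l} → k ≤ n → l ≤ n ∸ k → let m = n ∸ k ∸ l in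
                     fromℕ (multinomial n k l m) * fromℕ (k !) * fromℕ (l !) ≈ fromℕ (n !) * inv! m
  multinomial-inv! {n} {k} {l} k≤n l≤n∸k = sym (begin
    fromℕ (n !) * inv! m
      ≡⟨ ≡.cong (λ N → fromℕ N * inv! m) (multinomial-! k≤n l≤n∸k) ⟨
    fromℕ (M ℕ.* (k ! ℕ.* l ! ℕ.* m !)) * inv! m
      ≈⟨ *-congʳ (trans (×1-homo-* M _) (*-congˡ (trans (×1-homo-* (k ! ℕ.* l !) (m !))
           (*-congʳ (×1-homo-* (k !) (l !)))))) ⟩
    fromℕ M * (fromℕ (k !) * fromℕ (l !) * fromℕ (m !)) * inv! m
      ≈⟨ solve 5 (λ M k l m i → M :* (k :* l :* m) :* i := M :* k :* l :* (i :* m)) refl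
           (fromℕ M) (fromℕ (k !)) (fromℕ (l !)) (fromℕ (m !)) (inv! m) ⟩
    fromℕ M * fromℕ (k !) * fromℕ (l !) * (inv! m * fromℕ (m !))
      ≈⟨ *-congˡ (inv!-inverse m) ⟩
    fromℕ M * fromℕ (k !) * fromℕ (l !) * 1#
      ≈⟨ *-identityʳ _ ⟩
    fromℕ M * fromℕ (k !) * fromℕ (l !) ∎)
    where
    m = n ∸ k ∸ l
    M = multinomial n k l m

  exponential : Carrier → Series
  exponential x n = inv! n * x ^ n

  exponential-cong : ∀ {x y} → x ≈ y → exponential x S.≈ exponential y
  exponential-cong x≈y n = *-congˡ (^-congˡ n x≈y)

  exponential-0-apply : ∀ x → exponential x 0 ≈ 1#
  exponential-0-apply x = trans (*-congˡ (sym (+-identityʳ 1#))) (inv!-inverse 0)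

  exponential-0# : exponential 0# S.≈ S.1#
  exponential-0# zero    = exponential-0-apply 0#
  exponential-0# (suc n) = trans (*-congˡ (zeroˡ _)) (zeroʳ _)

  exponential-+ : ∀ x y → exponential x S.* exponential y S.≈ exponential (x + y)
  exponential-+ x y n = begin
    sum< (suc n) (λ i → inv! i * x ^ i * (inv! (n ∸ i) * y ^ (n ∸ i)))
      ≈⟨ sum<-cong (suc n) (λ i i<1+n → begin
           inv! i * x ^ i * (inv! (n ∸ i) * y ^ (n ∸ i))
             ≈⟨ solve 4 (λ i x j y → i :* x :* (j :* y) := i :* j :* (x :* y)) refl _ _ _ _ ⟩
           inv! i * inv! (n ∸ i) * (x ^ i * y ^ (n ∸ i))
             ≈⟨ *-congʳ (inv!-* (s≤s⁻¹ i<1+n)) ⟩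
           inv! n * fromℕ (n C i) * (x ^ i * y ^ (n ∸ i))
             ≈⟨ *-assoc _ _ _ ⟩
           inv! n * (fromℕ (n C i) * (x ^ i * y ^ (n ∸ i)))
             ≈⟨ *-congˡ (•≈fromℕ* (n C i) _) ⟨
           inv! n * ((n C i) • (x ^ i * y ^ (n ∸ i))) ∎) ⟩
    sum< (suc n) (λ i → inv! n * ((n C i) • (x ^ i * y ^ (n ∸ i))))
      ≈⟨ sum<-distribˡ (suc n) (inv! n) (λ i → (n C i) • (x ^ i * y ^ (n ∸ i))) ⟨
    inv! n * sum< (suc n) (λ i → (n C i) • (x ^ i * y ^ (n ∸ i)))
      ≈⟨ *-congˡ (Binomial.theorem commutativeSemiring n x y) ⟨
    inv! n * (x + y) ^ n ∎

  exponential-^ : ∀ x n → exponential x S′.^ n S.≈ exponential (fromℕ n * x)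
  exponential-^ x zero    = S.sym (S.trans (exponential-cong (zeroˡ x)) exponential-0#)
  exponential-^ x (suc n) =
    S.trans (S.*-congˡ {x = exponential x} (exponential-^ x n))
    (S.trans (exponential-+ x (fromℕ n * x))
    (exponential-cong (solve 2 (λ x n → x :+ n :* x := (con 1 :+ n) :* x) refl x (fromℕ n))))

  scale-exponential : ∀ a x → scale a (exponential x) S.≈ exponential (a * x)
  scale-exponential a x n = begin
    a ^ n * (inv! n * x ^ n)  ≈⟨ solve 3 (λ a i x → a :* (i :* x) := i :* (a :* x)) refl _ _ _ ⟩
    inv! n * (a ^ n * x ^ n)  ≈⟨ *-congˡ (^-distrib-* a x n) ⟨
    inv! n * (a * x) ^ n      ∎

-- Generalized Euler polynomials and power sums

module EulerSeries (R : CommutativeRing c ℓ) (inverseFactorials : InverseFactorials R)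
  (d : ℕ) (d-odd : Odd d)
  (χ : ℕ → CommutativeRing.Carrier R)
  (χ-periodic : ∀ a → CommutativeRing._≈_ R (χ (d ℕ.+ a)) (χ a)) where

  open InverseFactorials inverseFactorials
  open Exponential R inverseFactorials
  open SeriesRing R
  private
    module K where
      open CommutativeRing R public
      open RingOperations (CommutativeRing.rawRing R) public using (fromℕ)
      open SemiringMult semiring public using (×-homo-+)
      open SemiringSolver commutativeSemiring public
  open CommutativeRing seriesCommutativeRing
  open RingOperations seriesRing using (_^_; sum<)
  open CommutativeSemiringExp commutativeSemiring using (^-homo-*)
  open RingLemmas seriesCommutativeRing using (-‿^-odd; sum<-*-odd)
  open RingProperties ring using (-1*x≈-x)
  open SemiringSolver commutativeSemiring
  open SetoidReasoning setoid

  private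
    2# : Series
    2# = 1# + 1#

  term : ℕ → Series
  term a = (- 1#) ^ a * constant (χ a) * exponential (K.fromℕ a)

  denominator : Series
  denominator = exponential (K.fromℕ d) + 1#

  reciprocal : Series
  reciprocal = quotient 1# denominator (inv! 2)

  -- `generatingFunction` with x replaced by y, kept as a long division so that evaluation matches
  -- it piece by piece.
  eulerSeries : K.Carrier → Series
  eulerSeries y = quotient (2# * exponential y * sum< d term) denominator (inv! 2)

  powerSumSeries : ℕ → Series
  powerSumSeries w = sum< (w ℕ.* d) term

  H : Series
  H = sum< d term * reciprocal

  private
    1^n≈1 : ∀ n → 1# ^ n ≈ 1#
    1^n≈1 zero    = refl
    1^n≈1 (suc n) = trans (*-identityˡ _) (1^n≈1 n)

    [-1]^d≈-1 : (- 1#) ^ d ≈ - 1#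
    [-1]^d≈-1 = trans (-‿^-odd d-odd 1#) (-‿cong (1^n≈1 d))

    -- The minus sign is (-1)^d with d odd; the oddness of w enters separately, in `sum<-*-odd`.
    term-shift : ∀ a → term (d ℕ.+ a) ≈ - exponential (K.fromℕ d) * term a
    term-shift a = begin
      (- 1#) ^ (d ℕ.+ a) * constant (χ (d ℕ.+ a)) * exponential (K.fromℕ (d ℕ.+ a))
        ≈⟨ *-cong (*-cong (^-homo-* (- 1#) d a) (constant-cong (χ-periodic a)))
                  (exponential-cong (K.×-homo-+ K.1# d a)) ⟩
      (- 1#) ^ d * (- 1#) ^ a * constant (χ a) * exponential (K.fromℕ d K.+ K.fromℕ a)
        ≈⟨ *-cong (*-congʳ {x = constant (χ a)} (*-congʳ {x = (- 1#) ^ a} [-1]^d≈-1))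
             (sym (exponential-+ (K.fromℕ d) (K.fromℕ a))) ⟩
      - 1# * (- 1#) ^ a * constant (χ a) * (exponential (K.fromℕ d) * exponential (K.fromℕ a))
        ≈⟨ solve 5 (λ m s x e f → m :* s :* x :* (e :* f) := m :* e :* (s :* x :* f)) refl
             (- 1#) ((- 1#) ^ a) (constant (χ a)) (exponential (K.fromℕ d)) (exponential (K.fromℕ a)) ⟩
      - 1# * exponential (K.fromℕ d) * term a
        ≈⟨ *-congʳ {x = term a} (-1*x≈-x (exponential (K.fromℕ d))) ⟩
      - exponential (K.fromℕ d) * term a ∎

    -- The constant term is 1 + 1, whereas `fromℕ (2 !)` unfolds to 1 + (1 + 0).
    inv!2*denominator₀≈1 : inv! 2 K.* denominator 0 K.≈ K.1#
    inv!2*denominator₀≈1 = K.trans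
      (K.*-congˡ (K.+-cong (exponential-0-apply (K.fromℕ d)) (K.sym (K.+-identityʳ K.1#))))
      (inv!-inverse 2)

    -- Serves the Euler series and the power sum series alike, so that the same factor `reciprocal`,
    -- and with it `H`, appears in both.
    divide : ∀ {f g} → f * denominator ≈ g → f ≈ g * reciprocal
    divide {f} {g} fD≈g = begin
      f                               ≈⟨ *-identityʳ f ⟨
      f * 1#                          ≈⟨ *-congˡ {x = f} (quotient-* 1# denominator (inv! 2) inv!2*denominator₀≈1) ⟨
      f * (reciprocal * denominator)  ≈⟨ solve 3 (λ f r D → f :* (r :* D) := f :* D :* r) refl
                                           f reciprocal denominator ⟩
      f * denominator * reciprocal    ≈⟨ *-congʳ {x = reciprocal} fD≈g ⟩
      g * reciprocal                  ∎

  eulerSeries≈ : ∀ y → eulerSeries y ≈ 2# * exponential y * H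
  eulerSeries≈ y = trans
    (divide (quotient-* (2# * exponential y * sum< d term) denominator (inv! 2) inv!2*denominator₀≈1))
    (*-assoc (2# * exponential y) (sum< d term) reciprocal)

  powerSumSeries≈ : ∀ {w} → Odd w →
    powerSumSeries w ≈ H * (exponential (K.fromℕ w K.* K.fromℕ d) + 1#)
  powerSumSeries≈ {w} w-odd = begin
    powerSumSeries w
      ≈⟨ divide (sum<-*-odd d (exponential (K.fromℕ d)) term term-shift w-odd) ⟩
    sum< d term * (exponential (K.fromℕ d) ^ w + 1#) * reciprocal
      ≈⟨ *-congʳ {x = reciprocal} (*-congˡ {x = sum< d term} (+-congʳ {x = 1#} (exponential-^ (K.fromℕ d) w))) ⟩
    sum< d term * (exponential (K.fromℕ w K.* K.fromℕ d) + 1#) * reciprocal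
      ≈⟨ solve 3 (λ a e r → a :* e :* r := a :* r :* e) refl
           (sum< d term) (exponential (K.fromℕ w K.* K.fromℕ d) + 1#) reciprocal ⟩
    H * (exponential (K.fromℕ w K.* K.fromℕ d) + 1#) ∎

  scale-eulerSeries : ∀ a y → scale a (eulerSeries y) ≈ 2# * exponential (a K.* y) * scale a H
  scale-eulerSeries a y = begin
    scale a (eulerSeries y)
      ≈⟨ scale-cong K.refl (eulerSeries≈ y) ⟩
    scale a (2# * exponential y * H)
      ≈⟨ *-homo (2# * exponential y) H ⟩
    scale a (2# * exponential y) * scale a H
      ≈⟨ *-congʳ {x = scale a H} (*-homo 2# (exponential y)) ⟩
    scale a 2# * scale a (exponential y) * scale a H
      ≈⟨ *-congʳ {x = scale a H} (*-cong (trans (+-homo 1# 1#) (+-cong 1-homo 1-homo)) (scale-exponential a y)) ⟩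
    2# * exponential (a K.* y) * scale a H ∎
    where open RawRingHomomorphism (scaleHomomorphism a)

  scale-powerSumSeries : ∀ a {w} → Odd w →
    scale a (powerSumSeries w) ≈ scale a H * (exponential (a K.* (K.fromℕ w K.* K.fromℕ d)) + 1#)
  scale-powerSumSeries a {w} w-odd = begin
    scale a (powerSumSeries w)
      ≈⟨ scale-cong K.refl (powerSumSeries≈ w-odd) ⟩
    scale a (H * (E + 1#))
      ≈⟨ *-homo H (E + 1#) ⟩
    scale a H * scale a (E + 1#)
      ≈⟨ *-congˡ {x = scale a H} (trans (+-homo E 1#)
           (+-cong (scale-exponential a (K.fromℕ w K.* K.fromℕ d)) 1-homo)) ⟩
    scale a H * (exponential (a K.* (K.fromℕ w K.* K.fromℕ d)) + 1#) ∎
    where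
    open RawRingHomomorphism (scaleHomomorphism a)
    E = exponential (K.fromℕ w K.* K.fromℕ d)

  -- The product of the three rescaled series and its symmetry.

  module TripleProduct (y₁ y₂ : K.Carrier) where

    -- The scalings are the weights collected by the exponents k, l and m. The third parameter is a
    -- natural number because it also sets the length of the power sum. The nesting to the right
    -- mirrors the double sum over k and l.
    tripleProduct : K.Carrier → K.Carrier → ℕ → Series
    tripleProduct u v w =
      scale (v K.* K.fromℕ w) (eulerSeries (u K.* y₁)) *
      (scale (u K.* K.fromℕ w) (eulerSeries (v K.* y₂)) * scale (u K.* v) (powerSumSeries w))

    -- Here p stands for u v w, so invariance under permutations of u, v, w reduces to that of their
    -- product.
    prefactor : K.Carrier → Series
    prefactor p = 2# * exponential (p K.* y₁) * (2# * exponential (p K.* y₂)) *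
                  (exponential (p K.* K.fromℕ d) + 1#)

    symmetricProduct : K.Carrier → K.Carrier → K.Carrier → Series
    symmetricProduct u v w =
      prefactor (u K.* v K.* w) * (scale (v K.* w) H * (scale (u K.* w) H * scale (u K.* v) H))

    private
      prefactor-cong : ∀ {p q} → p K.≈ q → prefactor p ≈ prefactor q
      prefactor-cong p≈q = *-cong
        (*-cong (*-congˡ {x = 2#} (exponential-cong (K.*-congʳ p≈q)))
                (*-congˡ {x = 2#} (exponential-cong (K.*-congʳ p≈q))))
        (+-congʳ {x = 1#} (exponential-cong (K.*-congʳ p≈q)))

    tripleProduct≈symmetricProduct : ∀ u v {w} → Odd w →
      tripleProduct u v w ≈ symmetricProduct u v (K.fromℕ w)
    tripleProduct≈symmetricProduct u v {w} w-odd = begin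
      tripleProduct u v w
        ≈⟨ *-cong (scale-eulerSeries (v K.* W) (u K.* y₁))
             (*-cong (scale-eulerSeries (u K.* W) (v K.* y₂)) (scale-powerSumSeries (u K.* v) w-odd)) ⟩
      2# * exponential (v K.* W K.* (u K.* y₁)) * scale (v K.* W) H *
      (2# * exponential (u K.* W K.* (v K.* y₂)) * scale (u K.* W) H *
       (scale (u K.* v) H * (exponential (u K.* v K.* (W K.* K.fromℕ d)) + 1#)))
        ≈⟨ *-cong (*-congʳ {x = scale (v K.* W) H} (*-congˡ {x = 2#} (exponential-cong
             (K.solve 4 (λ u v w y → v K.:* w K.:* (u K.:* y) K.:= u K.:* v K.:* w K.:* y) K.refl u v W y₁))))
           (*-cong (*-congʳ {x = scale (u K.* W) H} (*-congˡ {x = 2#} (exponential-cong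
             (K.solve 4 (λ u v w y → u K.:* w K.:* (v K.:* y) K.:= u K.:* v K.:* w K.:* y) K.refl u v W y₂))))
             (*-congˡ {x = scale (u K.* v) H} (+-congʳ {x = 1#} (exponential-cong (K.sym (K.*-assoc (u K.* v) W (K.fromℕ d))))))) ⟩
      E₁ * scale (v K.* W) H * (E₂ * scale (u K.* W) H * (scale (u K.* v) H * E₃))
        ≈⟨ solve 6 (λ a b c x y z → a :* x :* (b :* y :* (z :* c)) := a :* b :* c :* (x :* (y :* z))) refl
             E₁ E₂ E₃ (scale (v K.* W) H) (scale (u K.* W) H) (scale (u K.* v) H) ⟩
      symmetricProduct u v W ∎
      where
      W  = K.fromℕ w
      E₁ = 2# * exponential (u K.* v K.* W K.* y₁)
      E₂ = 2# * exponential (u K.* v K.* W K.* y₂)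
      E₃ = exponential (u K.* v K.* W K.* K.fromℕ d) + 1#

    -- Together with the next transposition this generates all permutations of u, v, w.
    symmetricProduct-swap₁₂ : ∀ u v w → symmetricProduct u v w ≈ symmetricProduct v u w
    symmetricProduct-swap₁₂ u v w = *-cong (prefactor-cong (K.*-congʳ (K.*-comm u v))) (begin
      scale (v K.* w) H * (scale (u K.* w) H * scale (u K.* v) H)
        ≈⟨ solve 3 (λ x y z → x :* (y :* z) := y :* (x :* z)) refl
             (scale (v K.* w) H) (scale (u K.* w) H) (scale (u K.* v) H) ⟩
      scale (u K.* w) H * (scale (v K.* w) H * scale (u K.* v) H)
        ≈⟨ *-congˡ {x = scale (u K.* w) H} (*-congˡ {x = scale (v K.* w) H}
             (scale-cong {f = H} (K.*-comm u v) refl)) ⟩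
      scale (u K.* w) H * (scale (v K.* w) H * scale (v K.* u) H) ∎)

    symmetricProduct-swap₂₃ : ∀ u v w → symmetricProduct u v w ≈ symmetricProduct u w v
    symmetricProduct-swap₂₃ u v w = *-cong
      (prefactor-cong (K.solve 3 (λ u v w → u K.:* v K.:* w K.:= u K.:* w K.:* v) K.refl u v w))
      (*-cong (scale-cong {f = H} (K.*-comm v w) refl) (*-comm (scale (u K.* w) H) (scale (u K.* v) H)))

-- Reading the triple sum off the coefficients of the triple product.

module EulerCoefficients (R : CommutativeRing c ℓ) (inverseFactorials : InverseFactorials R)
  (d : ℕ) (d-odd : Odd d)
  (χ : ℕ → CommutativeRing.Carrier R)
  (χ-periodic : ∀ a → CommutativeRing._≈_ R (χ (d ℕ.+ a)) (χ a)) where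

  open CommutativeRing R renaming (rawRing to R-raw)
  open RingOperations R-raw using (_^_; sum<; fromℕ)
  open RingLemmas R using (sum<-cong; sum<-distribˡ)
  open InverseFactorials inverseFactorials
  open Exponential R inverseFactorials using (exponential; multinomial-inv!)
  open SeriesRing R
  open EulerSeries R inverseFactorials d d-odd χ χ-periodic
  open CommutativeSemiringExp commutativeSemiring using (^-homo-*; ^-distrib-*)
  open SemiringSolver commutativeSemiring
  open SetoidReasoning setoid
  private
    module S = CommutativeRing seriesCommutativeRing
    module constant = RawRingHomomorphism constantHomomorphism

  -- The shape of `T` over a commutative ring; over the field the two agree by definition.
  alternatingPowerSum : ℕ → ℕ → Carrier
  alternatingPowerSum m n = sum< (suc n) (λ a → (- 1#) ^ a * χ a * fromℕ a ^ m)

  -- In `term` the sign is a power taken in the series ring. Once it is recognised as a constant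
  -- series, sign and character together act as one scalar.
  term-apply : ∀ a m → term a m ≈ inv! m * ((- 1#) ^ a * χ a * fromℕ a ^ m)
  term-apply a m = begin
    term a m
      ≈⟨ S.*-congʳ {x = exponential (fromℕ a)} constant-coefficient m ⟨
    (constant ((- 1#) ^ a * χ a) S.* exponential (fromℕ a)) m
      ≈⟨ constant-* _ (exponential (fromℕ a)) m ⟩
    (- 1#) ^ a * χ a * (inv! m * fromℕ a ^ m)
      ≈⟨ solve 3 (λ x i p → x :* (i :* p) := i :* (x :* p)) refl ((- 1#) ^ a * χ a) (inv! m) _ ⟩
    inv! m * ((- 1#) ^ a * χ a * fromℕ a ^ m) ∎
    where
    open RingOperations seriesRing using () renaming (_^_ to _^ₛ_)
    [-1]^a : constant ((- 1#) ^ a) S.≈ (S.- S.1#) ^ₛ a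
    [-1]^a = S.trans (constant.^-homo (- 1#) a)
      (CommutativeSemiringExp.^-congˡ S.commutativeSemiring a (constant.-‿homo 1#))
    constant-coefficient : constant ((- 1#) ^ a * χ a) S.≈ (S.- S.1#) ^ₛ a S.* constant (χ a)
    constant-coefficient = S.trans (constant.*-homo ((- 1#) ^ a) (χ a))
      (S.*-congʳ {x = constant (χ a)} [-1]^a)

  powerSumSeries-apply : ∀ {w} → Odd w → ∀ m →
    powerSumSeries w m ≈ inv! m * alternatingPowerSum m (w ℕ.* d ∸ 1)
  powerSumSeries-apply {w} w-odd m = begin
    powerSumSeries w m
      ≈⟨ sum<-apply (w ℕ.* d) term m ⟩
    sum< (w ℕ.* d) (λ a → term a m)
      ≈⟨ sum<-cong (w ℕ.* d) (λ a _ → term-apply a m) ⟩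
    sum< (w ℕ.* d) (λ a → inv! m * ((- 1#) ^ a * χ a * fromℕ a ^ m))
      ≈⟨ sum<-distribˡ (w ℕ.* d) (inv! m) (λ a → (- 1#) ^ a * χ a * fromℕ a ^ m) ⟨
    inv! m * sum< (w ℕ.* d) (λ a → (- 1#) ^ a * χ a * fromℕ a ^ m)
      -- The power sum up to w d - 1 has (w d ∸ 1) + 1 terms, which is w d because odd numbers are
      -- nonzero.
      ≡⟨ ≡.cong (λ N → inv! m * sum< N (λ a → (- 1#) ^ a * χ a * fromℕ a ^ m))
           (ℕ.suc-pred (w ℕ.* d)) ⟨
    inv! m * alternatingPowerSum m (w ℕ.* d ∸ 1) ∎
    where instance _ = m*n≢0 w d {{Odd⇒NonZero w-odd}} {{Odd⇒NonZero d-odd}}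

  module _ (E : ℕ → Carrier → Carrier) (E≈ : ∀ k y → E k y ≈ fromℕ (k !) * eulerSeries y k)
    (y₁ y₂ : Carrier) where
    open TripleProduct y₁ y₂

    -- The nested Cauchy product is by definition the sum over k and l with m = n - k - l, so after
    -- n! is distributed only summands remain to be compared. `E` is abstract here; `E≈` is all that
    -- is known of it.
    tripleProduct-apply : ∀ n w₁ w₂ {w₃} → Odd w₃ →
      (sum< (suc n) λ k → sum< (suc (n ∸ k)) λ l → let m = n ∸ k ∸ l in
        fromℕ (multinomial n k l m)
          * E k (fromℕ w₁ * y₁) * E l (fromℕ w₂ * y₂) * alternatingPowerSum m (w₃ ℕ.* d ∸ 1)
          * fromℕ w₁ ^ (l ℕ.+ m) * fromℕ w₂ ^ (k ℕ.+ m) * fromℕ w₃ ^ (k ℕ.+ l))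
      ≈ fromℕ (n !) * tripleProduct (fromℕ w₁) (fromℕ w₂) w₃ n
    tripleProduct-apply n w₁ w₂ {w₃} w₃-odd = sym (trans
      (sum<-distribˡ (suc n) N (λ k → F₁ k * sum< (suc (n ∸ k)) (λ l → F₂ l * F₃ (n ∸ k ∸ l))))
      (sum<-cong (suc n) λ k k<1+n → let k≤n = s≤s⁻¹ k<1+n in trans
        (*-congˡ (sum<-distribˡ (suc (n ∸ k)) (F₁ k) (λ l → F₂ l * F₃ (n ∸ k ∸ l)))) (trans
        (sum<-distribˡ (suc (n ∸ k)) N (λ l → F₁ k * (F₂ l * F₃ (n ∸ k ∸ l))))
        (sum<-cong (suc (n ∸ k)) λ l l<1+n∸k → summand≈ k l k≤n (s≤s⁻¹ l<1+n∸k)))))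
      where
      N = fromℕ (n !)
      u = fromℕ w₁
      v = fromℕ w₂
      w = fromℕ w₃
      F₁ = scale (v * w) (eulerSeries (u * y₁))
      F₂ = scale (u * w) (eulerSeries (v * y₂))
      F₃ = scale (u * v) (powerSumSeries w₃)

      summand≈ : ∀ k l → k ≤ n → l ≤ n ∸ k → let m = n ∸ k ∸ l in
        N * (F₁ k * (F₂ l * F₃ m)) ≈
        fromℕ (multinomial n k l m)
          * E k (u * y₁) * E l (v * y₂) * alternatingPowerSum m (w₃ ℕ.* d ∸ 1)
          * u ^ (l ℕ.+ m) * v ^ (k ℕ.+ m) * w ^ (k ℕ.+ l)
      summand≈ k l k≤n l≤n∸k = begin
        N * ((v * w) ^ k * G₁ * ((u * w) ^ l * G₂ * ((u * v) ^ m * powerSumSeries w₃ m)))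
          ≈⟨ *-congˡ (*-cong (*-congʳ (^-distrib-* v w k)) (*-cong (*-congʳ (^-distrib-* u w l))
               (*-cong (^-distrib-* u v m) (powerSumSeries-apply w₃-odd m)))) ⟩
        N * (v ^ k * w ^ k * G₁ * (u ^ l * w ^ l * G₂ * (u ^ m * v ^ m * (inv! m * T))))
          ≈⟨ solve 11 (λ N vk wk G₁ ul wl G₂ um vm i T →
               N :* (vk :* wk :* G₁ :* (ul :* wl :* G₂ :* (um :* vm :* (i :* T)))) :=
               N :* i :* (G₁ :* G₂ :* T :* (ul :* um) :* (vk :* vm) :* (wk :* wl))) refl
               N (v ^ k) (w ^ k) G₁ (u ^ l) (w ^ l) G₂ (u ^ m) (v ^ m) (inv! m) T ⟩
        N * inv! m * (G₁ * G₂ * T * (u ^ l * u ^ m) * (v ^ k * v ^ m) * (w ^ k * w ^ l))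
          ≈⟨ *-cong (multinomial-inv! k≤n l≤n∸k)
               (*-cong (*-cong (*-congˡ (^-homo-* u l m)) (^-homo-* v k m)) (^-homo-* w k l)) ⟨
        M * fromℕ (k !) * fromℕ (l !) * (G₁ * G₂ * T * U * V * W)
          ≈⟨ solve 9 (λ M k l G₁ G₂ T U V W → M :* k :* l :* (G₁ :* G₂ :* T :* U :* V :* W) :=
               M :* (k :* G₁) :* (l :* G₂) :* T :* U :* V :* W) refl
               M (fromℕ (k !)) (fromℕ (l !)) G₁ G₂ T U V W ⟩
        M * (fromℕ (k !) * G₁) * (fromℕ (l !) * G₂) * T * U * V * W
          ≈⟨ *-congʳ (*-congʳ (*-congʳ (*-congʳ (*-cong (*-congˡ (E≈ k _)) (E≈ l _))))) ⟨
        M * E k (u * y₁) * E l (v * y₂) * T * U * V * W ∎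
        where
        m = n ∸ k ∸ l
        M = fromℕ (multinomial n k l m)
        G₁ = eulerSeries (u * y₁) k
        G₂ = eulerSeries (v * y₂) l
        T = alternatingPowerSum m (w₃ ℕ.* d ∸ 1)
        U = u ^ (l ℕ.+ m)
        V = v ^ (k ℕ.+ m)
        W = w ^ (k ℕ.+ l)

-- From polynomials in x to their values, and the symmetry of the triple sum.

module TripleSum (F : HeytingField c ℓ ℓ₂) (characteristicZero : CharacteristicZero F)
  (d : ℕ) (d-odd : Odd d)
  (χ : ℕ → HeytingField.Carrier F)
  (χ-periodic : ∀ a → HeytingField._≈_ F (χ (d ℕ.+ a)) (χ a)) where

  R : CommutativeRing _ _
  R = HeytingCommutativeRing.commutativeRing (HeytingField.heytingCommutativeRing F)

  open GeneralizedEuler F characteristicZero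
  open CommutativeRing R renaming (rawRing to R-raw)
  open RingOperations R-raw using (fromℕ)
  open Polynomials R-raw using (polynomialRing; X; evaluate)
  open RingProperties ring using (-0#≈0#)

  inverse-* : ∀ n .{{_ : NonZero n}} → inverse n * fromℕ n ≈ 1#
  inverse-* (suc n) = trans
    -- Apartness from 0 inverts the difference n - 0, not n itself.
    (*-congˡ (sym (trans (+-congˡ -0#≈0#) (+-identityʳ _))))
    (proj₁ (proj₂ (HeytingField.#⇒invertible F (characteristicZero n))))

  inverseFactorials : InverseFactorials R
  inverseFactorials = record
    { inv!         = λ n → inverse (n !) {{n !≢0}}
    ; inv!-inverse = λ n → inverse-* (n !) {{n !≢0}}
    }

  open Exponential R inverseFactorials using (exponential)
  open EulerSeries R inverseFactorials d d-odd χ χ-periodic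
  open EulerCoefficients R inverseFactorials d d-odd χ χ-periodic
  open SeriesRing R using (seriesCommutativeRing; constant; quotient-cong)
  open Evaluation R

  module _ (y : Carrier) where
    private
      module S  = CommutativeRing seriesCommutativeRing
      module S′ = RingOperations S.rawRing
      φ = evaluateHomomorphism y
      module φ = RawRingHomomorphism φ
      module ψ = RawRingHomomorphism (SeriesMap.seriesMap φ)
      module P[x]    = RingOperations polynomialRing
      module P[x]⟦t⟧ = RingOperations (PowerSeries.seriesRing polynomialRing)
      constantₓ = PowerSeries.constant polynomialRing

    exp-evaluate : ∀ q {x} → evaluate q y ≈ x → ψ.⟦ exp q ⟧ S.≈ exponential x
    exp-evaluate q q≈x n = trans (φ.*-homo [ inverse (n !) {{n !≢0}} ] (q P[x].^ n))
      (*-cong (evaluate-[] y _)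
        (trans (φ.^-homo q n) (CommutativeSemiringExp.^-congˡ commutativeSemiring n q≈x)))

    exp-fromℕ-evaluate : ∀ a → ψ.⟦ exp (P[x].fromℕ a) ⟧ S.≈ exponential (fromℕ a)
    exp-fromℕ-evaluate a = exp-evaluate (P[x].fromℕ a) (φ.fromℕ-homo a)

    -- Evaluation at y on coefficients is a homomorphism from K[x]⟦t⟧ to K⟦t⟧, so it can be followed
    -- through the defining expression; the local names restate the pieces of that expression.
    generatingFunction-evaluate : ψ.⟦ generatingFunction d χ ⟧ S.≈ eulerSeries y
    generatingFunction-evaluate n = trans
      (SeriesMap.quotient-homo φ numeratorₓ denominatorₓ [ inverse 2 ] n)
      -- The two leading inverses agree because 2! computes to 2.
      (quotient-cong numerator-evaluate denominator-evaluate (evaluate-[] y (inverse 2)) n)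
      where
      signₓ termₓ : ℕ → PowerSeries.Series polynomialRing
      signₓ a = (P[x]⟦t⟧.- P[x]⟦t⟧.1#) P[x]⟦t⟧.^ a
      termₓ a = signₓ a P[x]⟦t⟧.* constantₓ [ χ a ] P[x]⟦t⟧.* exp (P[x].fromℕ a)

      2ₓ numeratorₓ denominatorₓ : PowerSeries.Series polynomialRing
      2ₓ = P[x]⟦t⟧.1# P[x]⟦t⟧.+ P[x]⟦t⟧.1#
      numeratorₓ = 2ₓ P[x]⟦t⟧.* exp X P[x]⟦t⟧.* P[x]⟦t⟧.sum< d termₓ
      denominatorₓ = exp (P[x].fromℕ d) P[x]⟦t⟧.+ P[x]⟦t⟧.1#

      denominator-evaluate : ψ.⟦ denominatorₓ ⟧ S.≈ denominator
      denominator-evaluate = S.trans (ψ.+-homo (exp (P[x].fromℕ d)) P[x]⟦t⟧.1#)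
        (S.+-cong (exp-fromℕ-evaluate d) ψ.1-homo)

      constant-evaluate : ∀ a → ψ.⟦ constantₓ [ a ] ⟧ S.≈ constant a
      constant-evaluate a = S.trans (SeriesMap.constant-homo φ [ a ])
        (SeriesRing.constant-cong R (evaluate-[] y a))

      sign-evaluate : ∀ a → ψ.⟦ signₓ a ⟧ S.≈ (S.- S.1#) S′.^ a
      sign-evaluate a = S.trans (ψ.^-homo (P[x]⟦t⟧.- P[x]⟦t⟧.1#) a)
        (CommutativeSemiringExp.^-congˡ S.commutativeSemiring a
          (S.trans (ψ.-‿homo P[x]⟦t⟧.1#) (S.-‿cong ψ.1-homo)))

      term-evaluate : ∀ a → ψ.⟦ termₓ a ⟧ S.≈ term a
      term-evaluate a = S.trans (ψ.*-homo (signₓ a P[x]⟦t⟧.* constantₓ [ χ a ]) (exp (P[x].fromℕ a)))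
        (S.*-cong (S.trans (ψ.*-homo (signₓ a) (constantₓ [ χ a ]))
                     (S.*-cong (sign-evaluate a) (constant-evaluate (χ a))))
                  (exp-fromℕ-evaluate a))

      numerator-evaluate : ψ.⟦ numeratorₓ ⟧ S.≈ (S.1# S.+ S.1#) S.* exponential y S.* S′.sum< d term
      numerator-evaluate = S.trans (ψ.*-homo (2ₓ P[x]⟦t⟧.* exp X) (P[x]⟦t⟧.sum< d termₓ))
        (S.*-cong
          (S.trans (ψ.*-homo 2ₓ (exp X))
            (S.*-cong (S.trans (ψ.+-homo P[x]⟦t⟧.1# P[x]⟦t⟧.1#) (S.+-cong ψ.1-homo ψ.1-homo))
                      (exp-evaluate X (evaluate-X y))))
          (S.trans (ψ.sum<-homo d termₓ)
            (RingLemmas.sum<-cong seriesCommutativeRing d {g = term} (λ a _ → term-evaluate a))))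

    E≈ : ∀ k → E d χ k y ≈ fromℕ (k !) * eulerSeries y k
    E≈ k = trans (φ.·-homo (k !) (generatingFunction d χ k))
      (trans (RingLemmas.•≈fromℕ* R (k !) _) (*-congˡ (generatingFunction-evaluate k)))

  module _ (y₁ y₂ : Carrier) where
    open TripleProduct y₁ y₂

    private
      S : ℕ → ℕ → ℕ → ℕ → Carrier
      S n u v w = tripleSum d χ n u v w y₁ y₂

    tripleSum≈ : ∀ n u v {w} → Odd w →
      S n u v w ≈ fromℕ (n !) * symmetricProduct (fromℕ u) (fromℕ v) (fromℕ w) n
    tripleSum≈ n u v w-odd = trans
      (tripleProduct-apply (E d χ) (λ k y → E≈ y k) y₁ y₂ n u v w-odd)
      (*-congˡ (tripleProduct≈symmetricProduct (fromℕ u) (fromℕ v) w-odd n))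

    tripleSum-swap₁₂ : ∀ n u v {w} → Odd w → S n u v w ≈ S n v u w
    tripleSum-swap₁₂ n u v {w} w-odd = trans (tripleSum≈ n u v w-odd) (trans
      (*-congˡ (symmetricProduct-swap₁₂ (fromℕ u) (fromℕ v) (fromℕ w) n))
      (sym (tripleSum≈ n v u w-odd)))

    -- Each of v and w fixes the length of the power sum on one side, so each of them must be odd.
    tripleSum-swap₂₃ : ∀ n u {v w} → Odd v → Odd w → S n u v w ≈ S n u w v
    tripleSum-swap₂₃ n u {v} {w} v-odd w-odd = trans (tripleSum≈ n u v w-odd) (trans
      (*-congˡ (symmetricProduct-swap₂₃ (fromℕ u) (fromℕ v) (fromℕ w) n))
      (sym (tripleSum≈ n u w v-odd)))

theorem4p2 : ∀ {a b c a′ b′ c′ : Level} (p : ℕ) → Prime p → Odd p →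
    (ℂₚ : Complexₚ p a b c) (ℚ̄ : AlgebraicClosureOfℚ a′ b′ c′) →
    let module ℂₚ = Complexₚ ℂₚ
        module ℚ̄ = AlgebraicClosureOfℚ ℚ̄
    in
    (σ : ℚ̄.Carrier → ℂₚ.Carrier) →
    RingMorphisms.IsRingMonomorphism (rawRing ℚ̄.heytingField) (rawRing ℂₚ.heytingField) σ →
    (d : ℕ) → Odd d →
    (χ : DirichletCharacter ℚ̄.heytingField d) → DirichletCharacter.IsPrimitive χ →
    (w₁ w₂ w₃ : ℕ) → Odd w₁ → Odd w₂ → Odd w₃ →
    (n : ℕ) (y₁ y₂ : ℤₚ p) →
    let open GeneralizedEuler ℂₚ.heytingField ℂₚ.characteristicZero
        S = λ u v w → tripleSum d (λ i → σ (DirichletCharacter.χ χ (+ i))) n u v w (ℂₚ.ι y₁) (ℂₚ.ι y₂)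
        open ℂₚ using (_≈_)
    in
    (S w₁ w₂ w₃ ≈ S w₁ w₃ w₂) ×
    (S w₁ w₃ w₂ ≈ S w₂ w₁ w₃) ×
    (S w₂ w₁ w₃ ≈ S w₂ w₃ w₁) ×
    (S w₂ w₃ w₁ ≈ S w₃ w₂ w₁) ×
    (S w₃ w₂ w₁ ≈ S w₃ w₁ w₂)
theorem4p2 p _ _ ℂₚ ℚ̄ σ σ-mono d d-odd χ _ w₁ w₂ w₃ o₁ o₂ o₃ n y₁ y₂ =
    swap₂₃ w₁ o₂ o₃
  -- These two orders differ by a 3-cycle; the path goes back through the order w₁, w₂, w₃.
  , trans (swap₂₃ w₁ o₃ o₂) (swap₁₂ w₁ w₂ o₃)
  , swap₂₃ w₂ o₁ o₃
  , swap₁₂ w₂ w₃ o₁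
  , swap₂₃ w₃ o₂ o₁
  where
  module ℂₚ = Complexₚ ℂₚ
  open ℂₚ using (trans)
  open RingMorphisms.IsRingMonomorphism σ-mono using (⟦⟧-cong)
  module χ = DirichletCharacter χ

  -- Periodicity of χ is phrased as congruence of integers modulo d; a shift by d is the congruence
  -- with quotient 1.
  d∣[d+a]-a : ∀ a → (+ d) ℤ.∣ ((+ (d ℕ.+ a)) ℤ.- (+ a))
  d∣[d+a]-a a = ℤ.divides (+ 1) (lemma (+ d) (+ a))
    where
    lemma : ∀ x y → (x ℤ.+ y) ℤ.- y ≡ (+ 1) ℤ.* x
    lemma = solve-∀

  open TripleSum ℂₚ.heytingField ℂₚ.characteristicZero d d-odd (λ i → σ (χ.χ (+ i)))
    (λ a → ⟦⟧-cong (χ.periodic (d∣[d+a]-a a)))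
  swap₁₂ = tripleSum-swap₁₂ (ℂₚ.ι y₁) (ℂₚ.ι y₂) n
  swap₂₃ : ∀ u {v w} → Odd v → Odd w → _
  swap₂₃ = tripleSum-swap₂₃ (ℂₚ.ι y₁) (ℂₚ.ι y₂) n
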